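{- For all positive integers $a\ge b\ge c$ with $(a,b,c)\notin\{(1,1,1),(2,1,1),(3,1,1)\}$ we have $\chi_3([a,b,c])\ge 6$.
   Context: For positive integers $p,q,r$ let $\mathcal{CC}_1([p,q,r])=\{[x,x+p]\times[y,y+q]\times[z,z+r]: x,y,z\in\mathbb{Z}\}$, and let $\mathcal{CC}_3([a,b,c])$ be the union of $\mathcal{CC}_1([p,q,r])$ over all permutations $(p,q,r)$ of $(a,b,c)$ (congruent cuboids, arbitrary axis-parallel orientation). A configuration is a finite subset of $\mathcal{CC}_3([a,b,c])$ with pairwise disjoint interiors; two of its cuboids touch if their intersection is a non-degenerate two-dimensional rectangle; its contact graph has the cuboids as vertices and edges between touching cuboids. $\chi_3([a,b,c])$ is the maximum chromatic number of such a contact graph over all configurations; note it depends only on the multiset $\{a,b,c\}$. -}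

module Defs where

open import Data.Nat using (ℕ) renaming (_<_ to _<ℕ_)
open import Data.Empty using (⊥)
open import Data.Integer using (ℤ; +_; _+_; _-_; _⊓_; _⊔_; _<_; _≤_; 0ℤ)
open import Data.Fin using (Fin)
open import Data.Product using (Σ; _×_; ∃)
open import Data.Sum using (_⊎_)
open import Relation.Binary.PropositionalEquality using (_≡_; _≢_)

IsPerm3 : ℕ → ℕ → ℕ → ℕ → ℕ → ℕ → Set
IsPerm3 a b c p q r =
     (p ≡ a × q ≡ b × r ≡ c)
   ⊎ (p ≡ a × q ≡ c × r ≡ b)
   ⊎ (p ≡ b × q ≡ a × r ≡ c)
   ⊎ (p ≡ b × q ≡ c × r ≡ a)
   ⊎ (p ≡ c × q ≡ a × r ≡ b)
   ⊎ (p ≡ c × q ≡ b × r ≡ a)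

-- an element of CC_3([a,b,c]) : [x,x+p] × [y,y+q] × [z,z+r]
record Cuboid (a b c : ℕ) : Set where
  constructor cuboid
  field
    x y z : ℤ
    p q r : ℕ
    perm  : IsPerm3 a b c p q r
open Cuboid public

-- signed length of the intersection of the closed intervals [l₁,l₁+d₁] and [l₂,l₂+d₂]
-- (negative when the intervals are disjoint)
ovLen : ℤ → ℕ → ℤ → ℕ → ℤ
ovLen l₁ d₁ l₂ d₂ = ((l₁ + + d₁) ⊓ (l₂ + + d₂)) - (l₁ ⊔ l₂)

ovX ovY ovZ : ∀ {a b c} → Cuboid a b c → Cuboid a b c → ℤ
ovX C D = ovLen (x C) (p C) (x D) (p D)
ovY C D = ovLen (y C) (q C) (y D) (q D)
ovZ C D = ovLen (z C) (r C) (z D) (r D)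

DisjointInteriors : ∀ {a b c} → Cuboid a b c → Cuboid a b c → Set
DisjointInteriors C D = (ovX C D ≤ 0ℤ) ⊎ (ovY C D ≤ 0ℤ) ⊎ (ovZ C D ≤ 0ℤ)

Touch : ∀ {a b c} → Cuboid a b c → Cuboid a b c → Set
Touch C D =
     (ovX C D ≡ 0ℤ × 0ℤ < ovY C D × 0ℤ < ovZ C D)
   ⊎ (0ℤ < ovX C D × ovY C D ≡ 0ℤ × 0ℤ < ovZ C D)
   ⊎ (0ℤ < ovX C D × 0ℤ < ovY C D × ovZ C D ≡ 0ℤ)

-- a configuration: finitely many (n) cuboids of CC_3([a,b,c]) with pairwise
-- disjoint interiors (this also forces them to be distinct)
record Configuration (a b c : ℕ) : Set where
  field
    n       : ℕ
    cub     : Fin n → Cuboid a b c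
    disjoint : ∀ i j → i ≢ j → DisjointInteriors (cub i) (cub j)
open Configuration public

ProperColouring : ∀ {a b c} → Configuration a b c → ℕ → Set
ProperColouring K k =
  Σ (Fin (n K) → Fin k) λ col →
    ∀ i j → Touch (cub K i) (cub K j) → col i ≢ col j

χ₃≥ : ℕ → ℕ → ℕ → ℕ → Set
χ₃≥ a b c m = ∃ λ (K : Configuration a b c) → ∀ k → k <ℕ m → ProperColouring K k → ⊥

{-# OPTIONS --safe #-}

-- A strictly increasing map of the coordinates of an axis that sends the two ends of every side to
-- points at the prescribed distance preserves which cuboids touch and which have disjoint interiors.
-- Nine finite configurations, found by computer search and not 5-colourable, therefore suffice:
--   2×2×2 cubes of one orientation, in which each axis can be scaled separately (c ≥ 2);
--   2×2×1, and m×2×1 for m = 3, 4, 5 with the side 2 always along the first axis, so that this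
--   axis can be scaled, the last one having its two other axes extensible as well (b ≥ 2, c = 1);
--   m×1×1 for m = 4, 5, 6, 7, the last one extensible (b = c = 1).
module Submission where

open import Defs
open import Data.Bool.Base using (Bool; true; false; if_then_else_; _∧_; T)
open import Data.Empty using (⊥)
open import Data.Fin.Base as Fin using (Fin)
import Data.Fin.Properties as Fin
open import Data.Integer.Base as ℤ using (+_; 0ℤ)
import Data.Integer.Properties as ℤ
open import Data.List.Base using (List; []; _∷_; [_]; map; length; lookup)
open import Data.Bool.ListAction using (all; any)
open import Data.List.Membership.DecPropositional using (_∈?_)
open import Data.List.Membership.Propositional using (_∈_)
open import Data.List.Membership.Propositional.Properties using (∈-lookup)
open import Data.List.Relation.Binary.Pointwise.Base using (Pointwise; []; _∷_)
open import Data.List.Relation.Unary.All as All using (All; []; _∷_)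
import Data.List.Relation.Unary.All.Properties as All
open import Data.List.Relation.Unary.AllPairs using (AllPairs; []; _∷_; allPairs?)
open import Data.List.Relation.Unary.Any as Any using (Any; here; there)
import Data.List.Relation.Unary.Any.Properties as Any
open import Data.List.Relation.Unary.Unique.Propositional using (Unique)
open import Data.Nat.Base using
  (ℕ; zero; suc; _+_; _*_; _⊓_; _⊔_; _≤_; _<_; s≤s; z<s; NonZero)
open import Data.Nat.DivMod using
  (_/_; _%_; +-distrib-/; +-distrib-/-∣ʳ; n/n≡1; m<n⇒m/n≡0; m<n⇒m%n≡m; /-monoˡ-≤)
open import Data.Nat.Divisibility using (∣-refl)
open import Data.Nat.Properties
open import Data.Product.Base using (∃; _×_; _,_)
open import Data.Sum.Base as Sum using (_⊎_; inj₁; inj₂)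
open import Data.Unit.Base using (⊤; tt)
open import Function.Base using (_∘_; id)
open import Level using (0ℓ)
open import Relation.Binary.Core using (Rel)
open import Relation.Binary.Definitions using (Symmetric; Decidable; tri<; tri≈; tri>)
open import Relation.Binary.PropositionalEquality hiding ([_])
open import Relation.Nullary using (¬_; Dec; yes; no; does; contradiction)
open import Relation.Nullary.Decidable using (_×-dec_; _⊎-dec_; True; toWitness)

-- Pairwise relations along a list, and the pigeonhole principle.

lookup-< : ∀ {A : Set} {R : Rel A 0ℓ} {xs} → AllPairs R xs →
  ∀ {i j} → i Fin.< j → R (lookup xs i) (lookup xs j)
lookup-< (x~xs ∷ _) {Fin.zero}  {Fin.suc j} _         = All.lookup x~xs (∈-lookup j)
lookup-< (_ ∷ xs~)  {Fin.suc i} {Fin.suc j} (s≤s i<j) = lookup-< xs~ i<j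

lookup-≢ : ∀ {A : Set} {R : Rel A 0ℓ} {xs} → Symmetric R → AllPairs R xs →
  ∀ {i j} → i ≢ j → R (lookup xs i) (lookup xs j)
lookup-≢ R-sym xs~ {i} {j} i≢j with Fin.<-cmp i j
... | tri< i<j _ _   = lookup-< xs~ i<j
... | tri≈ _ i≡j _   = contradiction i≡j i≢j
... | tri> _ _ j<i   = R-sym (lookup-< xs~ j<i)

-- Pigeonhole: without repetitions, `lookup` injects the positions of the list into `Fin k`.
length-unique : ∀ {k} {xs : List (Fin k)} → Unique xs → length xs ≤ k
length-unique {xs = xs} u = Fin.injective⇒≤ {f = lookup xs} λ {i} {j} eq → injective i j eq
  where
  injective : ∀ i j → lookup xs i ≡ lookup xs j → i ≡ j
  injective i j eq with i Fin.≟ j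
  ... | yes i≡j = i≡j
  ... | no  i≢j = contradiction eq (lookup-≢ ≢-sym u i≢j)

-- A verified search for colourings.

-- Backtracking over partitions into independent classes instead of colourings; this breaks the
-- symmetry between the colours.
module Backtracking {V : Set} {_~_ : Rel V 0ℓ} (_~?_ : Decidable _~_) where

  adjacent : V → List V → Bool
  adjacent v = any (λ w → does (v ~? w))

  joins : V → List (List V) → List (List (List V))
  joins v []       = []
  joins v (C ∷ Cs) = if adjacent v C then rest else ((v ∷ C) ∷ Cs) ∷ rest
    where rest = map (C ∷_) (joins v Cs)

  -- The first argument is the number of classes that may still be opened.
  uncolourable : ℕ → List (List V) → List V → Bool
  -- Once every vertex is placed, the classes form a colouring, so the search has failed to refute.
  uncolourable n       Cs []       = false
  uncolourable zero    Cs (v ∷ vs) = all (λ Ds → uncolourable zero Ds vs) (joins v Cs)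
  uncolourable (suc n) Cs (v ∷ vs) =
    all (λ Ds → uncolourable (suc n) Ds vs) (joins v Cs) ∧ uncolourable n ([ v ] ∷ Cs) vs

  -- A colouring is given as a relation, so that vertices need not be indexed.
  module _ {k} (_hasColour_ : V → Fin k → Set)
           (proper : ∀ {v w κ} → v hasColour κ → w hasColour κ → ¬ v ~ w) where

    Monochromatic : List (List V) → List (Fin k) → Set
    Monochromatic = Pointwise (λ C κ → All (_hasColour κ) C)

    not-adjacent : ∀ {v κ} C → v hasColour κ → All (_hasColour κ) C → adjacent v C ≡ false
    not-adjacent         []      v∶κ []          = refl
    not-adjacent {v = v} (w ∷ C) v∶κ (w∶κ ∷ C∶κ) with v ~? w
    ... | yes v~w = contradiction v~w (proper v∶κ w∶κ)
    ... | no  _   = not-adjacent C v∶κ C∶κ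

    -- The class of colour `κ` contains no neighbour of `v`, because the colouring is proper; so the
    -- branch that follows the colouring is not pruned.
    joins-complete : ∀ {v κ Cs κs} → v hasColour κ → κ ∈ κs → Monochromatic Cs κs →
      Any (λ Ds → Monochromatic Ds κs) (joins v Cs)
    joins-complete {Cs = C ∷ Cs} v∶κ (here refl) (C∶κ ∷ Cs∶κs)
      rewrite not-adjacent C v∶κ C∶κ = here ((v∶κ ∷ C∶κ) ∷ Cs∶κs)
    joins-complete {v} {Cs = C ∷ Cs} v∶κ (there κ∈κs) (C∶κ ∷ Cs∶κs)
      -- `joins` keeps `rest` whether or not this class accepts `v`; acceptance only shifts it by
      -- one position.
      with ih ← Any.map⁺ (Any.map (C∶κ ∷_) (joins-complete v∶κ κ∈κs Cs∶κs)) | adjacent v C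
    ... | true  = ih
    ... | false = there ih

    uncolourable-sound : ∀ n {Cs κs} vs → k ≤ n + length κs → Unique κs → Monochromatic Cs κs →
      All (λ v → ∃ (v hasColour_)) vs → ¬ T (uncolourable n Cs vs)
    -- The case, common to both values of the counter, in which the colour of the next vertex
    -- already has a class.
    step : ∀ n {Cs κs v κ} vs → k ≤ n + length κs → Unique κs → Monochromatic Cs κs →
      All (λ v → ∃ (v hasColour_)) vs → v hasColour κ → κ ∈ κs →
      ¬ T (all (λ Ds → uncolourable n Ds vs) (joins v Cs))

    step n {Cs} {v = v} vs k≤ u Cs∶κs coloured v∶κ κ∈κs checked =
      let unc , Ds∶κs = All.lookupAny (All.all⁺ _ (joins v Cs) checked) (joins-complete v∶κ κ∈κs Cs∶κs)
      in uncolourable-sound n vs k≤ u Ds∶κs coloured unc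

    uncolourable-sound zero {κs = κs} (v ∷ vs) k≤ u Cs∶κs ((κ , v∶κ) ∷ coloured) checked
      with _∈?_ Fin._≟_ κ κs
    ... | yes κ∈κs = step zero vs k≤ u Cs∶κs coloured v∶κ κ∈κs checked
    -- A fresh colour would give `suc (length κs)` distinct colours, while `k ≤ length κs`.
    ... | no  κ∉κs = <⇒≱ (s≤s k≤) (length-unique (All.¬Any⇒All¬ κs κ∉κs ∷ u))
    uncolourable-sound (suc n) {Cs} {κs} (v ∷ vs) k≤ u Cs∶κs ((κ , v∶κ) ∷ coloured) checked
      -- Once the first conjunct is known to be `true`, `checked` reduces to the second, and `eq`
      -- recovers the first. If it is `false`, the type of `checked` is empty.
      with all (λ Ds → uncolourable (suc n) Ds vs) (joins v Cs) in eq | checked | _∈?_ Fin._≟_ κ κs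
    ... | true | _        | yes κ∈κs =
            step (suc n) vs k≤ u Cs∶κs coloured v∶κ κ∈κs (subst T (sym eq) tt)
    ... | true | checked′ | no  κ∉κs = uncolourable-sound n vs
            (subst (k ≤_) (sym (+-suc n (length κs))) k≤) (All.¬Any⇒All¬ κs κ∉κs ∷ u)
            ((v∶κ ∷ []) ∷ Cs∶κs) coloured checked′

-- Relative position of two intervals.

-- Comparisons of end points replace the sign of `ovLen`: they are decidable on naturals, and a
-- strictly increasing map transports them even though it changes lengths.
Overlap Abut Apart : (u d v e : ℕ) → Set
Overlap u d v e = u < v + e × v < u + d
Abut    u d v e = u + d ≡ v ⊎ v + e ≡ u
Apart   u d v e = u + d ≤ v ⊎ v + e ≤ u

overlap? : ∀ u d v e → Dec (Overlap u d v e)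
overlap? u d v e = (u <? v + e) ×-dec (v <? u + d)

abut? : ∀ u d v e → Dec (Abut u d v e)
abut? u d v e = (u + d ≟ v) ⊎-dec (v + e ≟ u)

apart? : ∀ u d v e → Dec (Apart u d v e)
apart? u d v e = (u + d ≤? v) ⊎-dec (v + e ≤? u)

ovLen-comm : ∀ u d v e → ovLen u d v e ≡ ovLen v e u d
ovLen-comm u d v e = cong₂ ℤ._-_ (ℤ.⊓-comm (u ℤ.+ + d) (v ℤ.+ + e)) (ℤ.⊔-comm u v)

-- Each left end must lie below each right end. The two comparisons between different intervals are
-- the hypothesis; the two within one interval are where positive lengths enter.
overlap⇒ovLen>0 : ∀ {u d v e} → 0 < d → 0 < e → Overlap u d v e → 0ℤ ℤ.< ovLen (+ u) d (+ v) e
overlap⇒ovLen>0 {u} {d} {v} {e} d>0 e>0 (u<v+e , v<u+d) = subst (ℤ._< ovLen (+ u) d (+ v) e)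
  (ℤ.+-inverseʳ (+ (u ⊔ v))) (ℤ.+-monoˡ-< (ℤ.- + (u ⊔ v)) (ℤ.+<+ max<min))
  where
  max<min : u ⊔ v < (u + d) ⊓ (v + e)
  max<min = ⊔-pres-<m (⊓-pres-m< (m<m+n u d>0) u<v+e) (⊓-pres-m< v<u+d (m<m+n v e>0))

abut⇒ovLen≡0 : ∀ {u d v e} → Abut u d v e → ovLen (+ u) d (+ v) e ≡ 0ℤ
abut⇒ovLen≡0 {u} {d} {v} {e} =
  Sum.[ left u d v e , trans (ovLen-comm (+ u) d (+ v) e) ∘ left v e u d ]
  where
  left : ∀ u d v e → u + d ≡ v → ovLen (+ u) d (+ v) e ≡ 0ℤ
  left u d _ e refl = ℤ.i≡j⇒i-j≡0 (cong +_
    (trans (m≤n⇒m⊓n≡m (m≤m+n (u + d) e)) (sym (m≤n⇒m⊔n≡n (m≤m+n u d)))))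

apart⇒ovLen≤0 : ∀ {u d v e} → Apart u d v e → ovLen (+ u) d (+ v) e ℤ.≤ 0ℤ
apart⇒ovLen≤0 {u} {d} {v} {e} =
  Sum.[ left u d v e , subst (ℤ._≤ 0ℤ) (ovLen-comm (+ v) e (+ u) d) ∘ left v e u d ]
  where
  left : ∀ u d v e → u + d ≤ v → ovLen (+ u) d (+ v) e ℤ.≤ 0ℤ
  left u d v e u+d≤v = ℤ.i≤j⇒i-j≤0
    (ℤ.+≤+ (≤-trans (m⊓n≤m (u + d) (v + e)) (≤-trans u+d≤v (m≤n⊔m u v))))

-- Bricks and finite templates.

-- Two of the six permutations are never needed.
data Orientation : Set where
  abc bca cab bac : Orientation

record Brick : Set where
  constructor brick
  field
    orientation : Orientation
    x₀ y₀ z₀    : ℕ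
open Brick

record Size : Set where
  constructor size
  field
    s₁ s₂ s₃ : ℕ
open Size

orient : Orientation → Size → Size
orient abc (size a b c) = size a b c
orient bca (size a b c) = size b c a
orient cab (size a b c) = size c a b
orient bac (size a b c) = size b a c

orient-perm : ∀ o {a b c} → let size p q r = orient o (size a b c) in IsPerm3 a b c p q r
orient-perm abc = inj₁ (refl , refl , refl)
orient-perm bac = inj₂ (inj₂ (inj₁ (refl , refl , refl)))
orient-perm bca = inj₂ (inj₂ (inj₂ (inj₁ (refl , refl , refl))))
orient-perm cab = inj₂ (inj₂ (inj₂ (inj₂ (inj₁ (refl , refl , refl)))))

width depth height : Size → Brick → ℕ
width  s B = s₁ (orient (orientation B) s)
depth  s B = s₂ (orient (orientation B) s)
height s B = s₃ (orient (orientation B) s)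

module _ (s : Size) where

  OnX OnY OnZ : ((u d v e : ℕ) → Set) → Rel Brick 0ℓ
  OnX P B C = P (x₀ B) (width  s B) (x₀ C) (width  s C)
  OnY P B C = P (y₀ B) (depth  s B) (y₀ C) (depth  s C)
  OnZ P B C = P (z₀ B) (height s B) (z₀ C) (height s C)

  Touching : Rel Brick 0ℓ
  Touching B C = (OnX Abut B C × OnY Overlap B C × OnZ Overlap B C)
               ⊎ (OnX Overlap B C × OnY Abut B C × OnZ Overlap B C)
               ⊎ (OnX Overlap B C × OnY Overlap B C × OnZ Abut B C)

  Separate : Rel Brick 0ℓ
  Separate B C = OnX Apart B C ⊎ OnY Apart B C ⊎ OnZ Apart B C

  touching? : Decidable Touching
  touching? B C =
    (abut? _ _ _ _ ×-dec overlap? _ _ _ _ ×-dec overlap? _ _ _ _) ⊎-dec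
    (overlap? _ _ _ _ ×-dec abut? _ _ _ _ ×-dec overlap? _ _ _ _) ⊎-dec
    (overlap? _ _ _ _ ×-dec overlap? _ _ _ _ ×-dec abut? _ _ _ _)

  separate? : Decidable Separate
  separate? B C = apart? _ _ _ _ ⊎-dec apart? _ _ _ _ ⊎-dec apart? _ _ _ _

  separate-sym : Symmetric Separate
  separate-sym = Sum.map Sum.swap (Sum.map Sum.swap Sum.swap)

  open Backtracking touching? public using () renaming (uncolourable to stuck)

  -- Both fields reduce to the unit type when the check succeeds, so `template tt tt` makes the type
  -- checker carry out the whole search, starting with no class and five that may be opened.
  record Template (Bs : List Brick) : Set where
    constructor template
    field
      separate : True (allPairs? separate? Bs)
      stuck₅   : T (stuck 5 [] Bs)

-- Transport along strictly increasing maps.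

record Stretch (f : ℕ → ℕ) : Set where
  constructor stretching
  field strict : ∀ {u v} → u < v → f u < f v

  weak : ∀ {u v} → u ≤ v → f u ≤ f v
  weak {u} {v} u≤v with m≤n⇒m<n∨m≡n u≤v
  ... | inj₁ u<v  = <⇒≤ (strict u<v)
  ... | inj₂ refl = ≤-refl

  module _ {u d d′ v e e′} (fu : f u + d′ ≡ f (u + d)) (fv : f v + e′ ≡ f (v + e)) where

    -- By `fu` and `fv` the right ends of the images are again values of `f`, so each of the three
    -- relations becomes a comparison of values of `f`: strict for `Overlap`, an equality for
    -- `Abut`, weak for `Apart`.
    overlap⁺ : Overlap u d v e → Overlap (f u) d′ (f v) e′
    overlap⁺ (u<v+e , v<u+d) =
      subst (f u <_) (sym fv) (strict u<v+e) , subst (f v <_) (sym fu) (strict v<u+d)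

    abut⁺ : Abut u d v e → Abut (f u) d′ (f v) e′
    abut⁺ = Sum.map (λ eq → trans fu (cong f eq)) (λ eq → trans fv (cong f eq))

    apart⁺ : Apart u d v e → Apart (f u) d′ (f v) e′
    apart⁺ = Sum.map (λ le → subst (_≤ f v) (sym fu) (weak le))
                     (λ le → subst (_≤ f u) (sym fv) (weak le))

Fits : (f g h : ℕ → ℕ) → Size → Size → Brick → Set
Fits f g h s t B = f (x₀ B) + width  t B ≡ f (x₀ B + width  s B)
                 × g (y₀ B) + depth  t B ≡ g (y₀ B + depth  s B)
                 × h (z₀ B) + height t B ≡ h (z₀ B + height s B)

stretch : (f g h : ℕ → ℕ) → Brick → Brick
stretch f g h (brick o x y z) = brick o (f x) (g y) (h z)

module _ {f g h} (F : Stretch f) (G : Stretch g) (H : Stretch h) {s t : Size} where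
  private
    module F = Stretch F
    module G = Stretch G
    module H = Stretch H

  stretch-touching : ∀ B C → Fits f g h s t B → Fits f g h s t C →
    Touching s B C → Touching t (stretch f g h B) (stretch f g h C)
  stretch-touching _ _ (fB , gB , hB) (fC , gC , hC) = Sum.map
    (λ (i , j , k) → F.abut⁺ fB fC i , G.overlap⁺ gB gC j , H.overlap⁺ hB hC k)
    (Sum.map (λ (i , j , k) → F.overlap⁺ fB fC i , G.abut⁺ gB gC j , H.overlap⁺ hB hC k)
             (λ (i , j , k) → F.overlap⁺ fB fC i , G.overlap⁺ gB gC j , H.abut⁺ hB hC k))

  stretch-separate : ∀ B C → Fits f g h s t B → Fits f g h s t C →
    Separate s B C → Separate t (stretch f g h B) (stretch f g h C)
  stretch-separate _ _ (fB , gB , hB) (fC , gC , hC) =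
    Sum.map (F.apart⁺ fB fC) (Sum.map (G.apart⁺ gB gC) (H.apart⁺ hB hC))

-- From templates to configurations.

module _ {a b c} (a>0 : 0 < a) (b>0 : 0 < b) (c>0 : 0 < c) where

  private
    t : Size
    t = size a b c

  cuboidOf : Brick → Cuboid a b c
  cuboidOf B = cuboid (+ x₀ B) (+ y₀ B) (+ z₀ B) (width t B) (depth t B) (height t B)
    (orient-perm (orientation B))

  positive : ∀ B → 0 < width t B × 0 < depth t B × 0 < height t B
  positive (brick abc _ _ _) = a>0 , b>0 , c>0
  positive (brick bca _ _ _) = b>0 , c>0 , a>0
  positive (brick cab _ _ _) = c>0 , a>0 , b>0
  positive (brick bac _ _ _) = b>0 , a>0 , c>0

  separate⇒disjoint : ∀ B C → Separate t B C → DisjointInteriors (cuboidOf B) (cuboidOf C)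
  separate⇒disjoint _ _ = Sum.map apart⇒ovLen≤0 (Sum.map apart⇒ovLen≤0 apart⇒ovLen≤0)

  touching⇒touch : ∀ B C → Touching t B C → Touch (cuboidOf B) (cuboidOf C)
  touching⇒touch B C =
    let pB , qB , rB = positive B
        pC , qC , rC = positive C
    in Sum.map
      (λ (i , j , k) → abut⇒ovLen≡0 i , overlap⇒ovLen>0 qB qC j , overlap⇒ovLen>0 rB rC k)
      (Sum.map (λ (i , j , k) → overlap⇒ovLen>0 pB pC i , abut⇒ovLen≡0 j , overlap⇒ovLen>0 rB rC k)
               (λ (i , j , k) → overlap⇒ovLen>0 pB pC i , overlap⇒ovLen>0 qB qC j , abut⇒ovLen≡0 k))

  -- Contacts of the template survive the stretching, so a proper colouring of the stretched
  -- configuration pulls back to one of the template.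
  template⇒χ₃≥6 : ∀ {f g h s Bs} → Stretch f → Stretch g → Stretch h →
    Template s Bs → All (Fits f g h s t) Bs → χ₃≥ a b c 6
  template⇒χ₃≥6 {f} {g} {h} {s} {Bs} F G H (template sep stuck₅) fits = K , not-colourable
    where
    fit : ∀ i → Fits f g h s t (lookup Bs i)
    fit i = All.lookup fits (∈-lookup i)

    place : Brick → Cuboid a b c
    place B = cuboidOf (stretch f g h B)

    disjoint-place : ∀ i j → i ≢ j → DisjointInteriors (place (lookup Bs i)) (place (lookup Bs j))
    disjoint-place i j i≢j =
      let B = lookup Bs i
          C = lookup Bs j
      in separate⇒disjoint (stretch f g h B) (stretch f g h C)
           (stretch-separate F G H {s} B C (fit i) (fit j) (lookup-≢ (λ {D E} → separate-sym s {D} {E}) (toWitness sep) i≢j))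

    touch-place : ∀ i j → Touching s (lookup Bs i) (lookup Bs j) →
      Touch (place (lookup Bs i)) (place (lookup Bs j))
    touch-place i j touching =
      let B = lookup Bs i
          C = lookup Bs j
      in touching⇒touch (stretch f g h B) (stretch f g h C)
           (stretch-touching F G H {s} B C (fit i) (fit j) touching)

    K : Configuration a b c
    K = record { n = length Bs ; cub = place ∘ lookup Bs ; disjoint = disjoint-place }

    not-colourable : ∀ k → k < 6 → ProperColouring K k → ⊥
    not-colourable k (s≤s k≤5) (col , proper) = Backtracking.uncolourable-sound (touching? s)
      Coloured (λ {B C} → independent {B} {C}) 5 Bs k≤5 [] [] coloured stuck₅
      where
      Coloured : Brick → Fin k → Set
      Coloured B κ = ∃ λ i → lookup Bs i ≡ B × col i ≡ κ

      independent : ∀ {B C κ} → Coloured B κ → Coloured C κ → ¬ Touching s B C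
      independent (i , refl , refl) (j , refl , eq) touching =
        proper i j (touch-place i j touching) (sym eq)

      coloured : All (λ B → ∃ (Coloured B)) Bs
      coloured = All.tabulate λ B∈Bs →
        let i = Any.index B∈Bs in col i , i , sym (Any.lookup-index B∈Bs) , refl

-- The stretching maps.

id-stretch : Stretch id
id-stretch = stretching id

-- Lengthens the unit intervals [m - 1 , m] + mℕ by e: an interval of length m contains exactly one of
-- them, and a unit interval elsewhere keeps its length.
widen : ∀ m .{{_ : NonZero m}} → ℕ → ℕ → ℕ
widen m e u = u + u / m * e

widen-stretch : ∀ m .{{_ : NonZero m}} e → Stretch (widen m e)
widen-stretch m e = stretching λ u<v → +-mono-<-≤ u<v (*-monoˡ-≤ e (/-monoˡ-≤ m (<⇒≤ u<v)))

-- Moving from `u` to `u + m` raises the quotient by `m` by exactly one, wherever `u` lies, and so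
-- adds `e` once.
widen-long : ∀ m .{{_ : NonZero m}} e u → widen m e u + (m + e) ≡ widen m e (u + m)
widen-long m e u = begin
  u + t * e + (m + e)     ≡⟨ +-assoc u (t * e) (m + e) ⟩
  u + (t * e + (m + e))   ≡⟨ cong (_+_ u) (+-comm (t * e) (m + e)) ⟩
  u + (m + e + t * e)     ≡⟨ cong (_+_ u) (+-assoc m e (t * e)) ⟩
  u + (m + suc t * e)     ≡⟨ +-assoc u m (suc t * e) ⟨
  u + m + suc t * e       ≡⟨ cong (λ i → u + m + i * e) [u+m]/m ⟨
  u + m + (u + m) / m * e ∎
  where
  open ≡-Reasoning
  t = u / m
  [u+m]/m : (u + m) / m ≡ suc t
  [u+m]/m = trans (+-distrib-/-∣ʳ u ∣-refl) (trans (cong (_+_ t) (n/n≡1 m)) (+-comm t 1))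

-- The hypothesis says that no multiple of `m` lies in the half-open interval from `u` (excluded) to
-- `u + l` (included), so both ends have the same quotient.
widen-short : ∀ m .{{_ : NonZero m}} e u l → u % m + l < m → widen m e u + l ≡ widen m e (u + l)
widen-short m e u l r<m = begin
  u + u / m * e + l       ≡⟨ +-assoc u (u / m * e) l ⟩
  u + (u / m * e + l)     ≡⟨ cong (_+_ u) (+-comm (u / m * e) l) ⟩
  u + (l + u / m * e)     ≡⟨ +-assoc u l (u / m * e) ⟨
  u + l + u / m * e       ≡⟨ cong (λ t → u + l + t * e) quotient ⟨
  u + l + (u + l) / m * e ∎
  where
  open ≡-Reasoning
  l<m : l < m
  l<m = ≤-<-trans (m≤n+m l (u % m)) r<m
  quotient : (u + l) / m ≡ u / m
  quotient = trans (+-distrib-/ u l (subst (λ t → u % m + t < m) (sym (m<n⇒m%n≡m l<m)) r<m))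
    (trans (cong (_+_ (u / m)) (m<n⇒m/n≡0 l<m)) (+-identityʳ (u / m)))

-- Cubes: all sides at least 2.

-- A cube of side 2 looks the same in all orientations. Fixing `abc` reserves one axis for each of
-- the three target sides, so the axes can be widened independently.
Upright : Brick → Set
Upright (brick abc _ _ _) = ⊤
Upright (brick bca _ _ _) = ⊥
Upright (brick cab _ _ _) = ⊥
Upright (brick bac _ _ _) = ⊥

upright? : ∀ B → Dec (Upright B)
upright? (brick abc _ _ _) = yes tt
upright? (brick bca _ _ _) = no id
upright? (brick cab _ _ _) = no id
upright? (brick bac _ _ _) = no id

-- In this and the following lists the bricks are ordered so that every initial segment has few
-- 5-colourings up to renaming, which keeps the backtracking short.
cubes : List Brick
cubes =
  brick abc 7 5 9 ∷ brick abc 8 7 9 ∷ brick abc 6 7 8 ∷ brick abc 8 6 7 ∷ brick abc 6 5 7 ∷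
  brick abc 9 5 9 ∷ brick abc 8 4 7 ∷ brick abc 10 7 8 ∷ brick abc 8 8 7 ∷ brick abc 10 5 7 ∷
  brick abc 10 7 6 ∷ brick abc 6 7 6 ∷ brick abc 8 7 5 ∷ brick abc 9 5 5 ∷ brick abc 7 5 5 ∷
  brick abc 7 9 5 ∷ brick abc 6 9 7 ∷ brick abc 9 9 5 ∷ brick abc 10 9 7 ∷ brick abc 8 10 7 ∷
  brick abc 9 9 9 ∷ brick abc 7 9 9 ∷ brick abc 6 7 4 ∷ brick abc 10 7 4 ∷ brick abc 8 6 3 ∷
  brick abc 8 8 3 ∷ brick abc 5 5 5 ∷ brick abc 6 3 6 ∷ brick abc 8 3 5 ∷ brick abc 6 3 8 ∷
  brick abc 5 5 9 ∷ brick abc 4 4 7 ∷ brick abc 4 6 7 ∷ brick abc 6 5 3 ∷ brick abc 8 4 3 ∷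
  brick abc 6 3 4 ∷ brick abc 4 7 5 ∷ brick abc 4 8 7 ∷ brick abc 5 9 5 ∷ brick abc 4 7 9 ∷
  brick abc 5 9 9 ∷ brick abc 6 9 3 ∷ brick abc 6 7 2 ∷ brick abc 4 6 3 ∷ brick abc 4 8 3 ∷
  brick abc 3 5 5 ∷ brick abc 4 10 7 ∷ brick abc 3 9 5 ∷ brick abc 2 7 6 ∷ brick abc 2 7 4 ∷
  brick abc 2 7 8 ∷ brick abc 2 5 7 ∷ brick abc 3 5 9 ∷ brick abc 2 9 7 ∷ brick abc 3 9 9 ∷
  brick abc 1 5 5 ∷ brick abc 2 7 10 ∷ brick abc 8 2 7 ∷ brick abc 1 5 9 ∷ brick abc 2 3 6 ∷
  brick abc 2 3 8 ∷ brick abc 0 4 7 ∷ brick abc 4 2 6 ∷ brick abc 6 1 7 ∷ brick abc 4 2 8 ∷ []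

cubes-template : Template (size 2 2 2) cubes
cubes-template = template tt tt

cubes≥6 : ∀ i j k → χ₃≥ (2 + i) (2 + j) (2 + k) 6
cubes≥6 i j k = template⇒χ₃≥6 z<s z<s z<s (widen-stretch 2 i) (widen-stretch 2 j) (widen-stretch 2 k)
  cubes-template (All.map (λ {B} → fits {B}) (toWitness {a? = All.all? upright? cubes} tt))
  where
  fits : ∀ {B} → Upright B →
    Fits (widen 2 i) (widen 2 j) (widen 2 k) (size 2 2 2) (size (2 + i) (2 + j) (2 + k)) B
  fits {brick abc x y z} _ = widen-long 2 i x , widen-long 2 j y , widen-long 2 k z

-- Slabs and planks: `b ≥ 2` and `c = 1`.

unstretched : ∀ {a b c Bs} → 0 < a → 0 < b → 0 < c → Template (size a b c) Bs → χ₃≥ a b c 6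
unstretched {Bs = Bs} a>0 b>0 c>0 t = template⇒χ₃≥6 a>0 b>0 c>0 id-stretch id-stretch id-stretch t
  (All.universal (λ _ → refl , refl , refl) Bs)

slabs : List Brick
slabs =
  brick cab 4 2 6 ∷ brick cab 5 3 5 ∷ brick bca 3 4 6 ∷ brick cab 4 3 4 ∷ brick cab 3 2 5 ∷
  brick abc 4 1 5 ∷ brick abc 2 2 7 ∷ brick bca 3 1 6 ∷ brick abc 5 1 6 ∷ brick abc 5 2 4 ∷
  brick bca 3 2 3 ∷ brick abc 6 2 5 ∷ brick cab 3 0 4 ∷ brick abc 4 0 4 ∷ brick bca 4 0 5 ∷
  brick cab 6 0 4 ∷ brick abc 5 1 3 ∷ brick abc 3 0 3 ∷ brick cab 7 1 3 ∷ brick abc 4 3 3 ∷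
  brick abc 5 4 4 ∷ brick abc 6 3 3 ∷ brick abc 7 3 4 ∷ brick bca 4 5 5 ∷ brick abc 6 4 5 ∷
  brick cab 7 5 3 ∷ brick cab 4 5 3 ∷ brick abc 5 5 3 ∷ brick bca 5 6 4 ∷ brick cab 3 4 4 ∷
  brick cab 2 3 5 ∷ brick bca 2 3 3 ∷ brick cab 2 1 4 ∷ brick abc 3 6 5 ∷ brick abc 2 5 6 ∷
  brick cab 2 5 4 ∷ brick cab 6 3 6 ∷ brick cab 6 5 6 ∷ brick bca 4 6 6 ∷ brick bca 4 7 3 ∷
  brick bca 5 7 5 ∷ brick bca 6 7 3 ∷ brick abc 1 1 3 ∷ brick cab 1 2 4 ∷ brick bca 1 4 3 ∷
  brick cab 1 4 5 ∷ brick abc 1 1 6 ∷ brick bca 0 1 4 ∷ brick bca 1 0 3 ∷ brick cab 3 6 3 ∷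
  brick cab 3 4 2 ∷ brick abc 3 6 2 ∷ brick abc 4 4 2 ∷ brick bca 3 3 1 ∷ brick abc 1 3 2 ∷
  brick cab 2 5 2 ∷ brick abc 2 4 1 ∷ brick bca 5 3 1 ∷ brick abc 4 4 1 ∷ brick cab 6 4 1 ∷
  brick bca 5 6 1 ∷ brick cab 1 5 3 ∷ brick bca 1 7 2 ∷ brick cab 1 5 1 ∷ brick cab 2 6 0 ∷
  brick cab 0 4 2 ∷ brick abc 0 3 1 ∷ brick cab 2 2 0 ∷ brick abc 1 4 0 ∷ brick abc 3 3 0 ∷
  brick abc 3 5 0 ∷ []

slabs-template : Template (size 2 2 1) slabs
slabs-template = template tt tt

Sideways : Brick → Set
Sideways (brick abc _ _ _) = ⊥
Sideways (brick bca _ _ _) = ⊤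
Sideways (brick cab _ _ _) = ⊥
Sideways (brick bac _ _ _) = ⊤

sideways? : ∀ B → Dec (Sideways B)
sideways? (brick abc _ _ _) = no id
sideways? (brick bca _ _ _) = yes tt
sideways? (brick cab _ _ _) = no id
sideways? (brick bac _ _ _) = yes tt

-- Both sideways orientations start with `b`, so every width in the template is 2 and `widen-long`
-- applies at any `x`, while the other two axes stay fixed.
sideways≥6 : ∀ {m Bs} → Template (size (suc m) 2 1) Bs → All Sideways Bs →
  ∀ j → χ₃≥ (suc m) (2 + j) 1 6
sideways≥6 {m} t sideways j = template⇒χ₃≥6 z<s z<s z<s (widen-stretch 2 j) id-stretch id-stretch
  t (All.map (λ {B} → fits {B}) sideways)
  where
  fits : ∀ {B} → Sideways B → Fits (widen 2 j) id id (size (suc m) 2 1) (size (suc m) (2 + j) 1) B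
  fits {brick bca x _ _} _ = widen-long 2 j x , refl , refl
  fits {brick bac x _ _} _ = widen-long 2 j x , refl , refl

planks3 : List Brick
planks3 =
  brick bca 5 3 4 ∷ brick bac 3 2 4 ∷ brick bca 5 4 2 ∷ brick bac 4 4 5 ∷ brick bac 4 5 4 ∷
  brick bca 6 4 5 ∷ brick bca 6 5 4 ∷ brick bac 4 4 6 ∷ brick bca 6 6 4 ∷ brick bac 5 5 3 ∷
  brick bac 3 4 3 ∷ brick bca 2 5 4 ∷ brick bca 2 6 4 ∷ brick bac 5 5 7 ∷ brick bac 3 5 7 ∷
  brick bca 2 4 5 ∷ brick bca 4 4 7 ∷ brick bac 7 5 7 ∷ brick bac 6 3 8 ∷ brick bac 8 4 6 ∷
  brick bac 8 4 5 ∷ brick bca 7 3 5 ∷ brick bca 8 4 7 ∷ []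

planks3-template : Template (size 3 2 1) planks3
planks3-template = template tt tt

planks3≥6 : ∀ j → χ₃≥ 3 (2 + j) 1 6
planks3≥6 = sideways≥6 planks3-template (toWitness {a? = All.all? sideways? planks3} tt)

planks4 : List Brick
planks4 =
  brick bca 2 7 6 ∷ brick bca 3 6 6 ∷ brick bac 3 4 5 ∷ brick bca 1 6 3 ∷ brick bca 1 7 2 ∷
  brick bca 2 8 5 ∷ brick bac 4 7 6 ∷ brick bac 3 6 4 ∷ brick bac 4 8 5 ∷ brick bac 4 7 7 ∷
  brick bca 2 9 5 ∷ brick bca 2 10 4 ∷ brick bca 5 6 4 ∷ brick bca 3 11 6 ∷ brick bca 5 11 6 ∷
  brick bca 6 10 4 ∷ brick bca 4 10 1 ∷ brick bac 3 6 3 ∷ brick bca 5 7 2 ∷ brick bca 1 8 1 ∷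
  brick bca 1 9 1 ∷ brick bac 3 6 2 ∷ brick bca 2 10 0 ∷ []

planks4-template : Template (size 4 2 1) planks4
planks4-template = template tt tt

planks4≥6 : ∀ j → χ₃≥ 4 (2 + j) 1 6
planks4≥6 = sideways≥6 planks4-template (toWitness {a? = All.all? sideways? planks4} tt)

-- The coordinate tested is where the side of length 1 starts; that side must avoid the lengthened
-- intervals `[4 , 5] + 5ℕ`.
Liftable : Brick → Set
Liftable (brick bac _ _ z) = z % 5 + 1 < 5
Liftable (brick bca _ y _) = y % 5 + 1 < 5
Liftable (brick abc _ _ _) = ⊥
Liftable (brick cab _ _ _) = ⊥

liftable? : ∀ B → Dec (Liftable B)
liftable? (brick bac _ _ z) = z % 5 + 1 <? 5
liftable? (brick bca _ y _) = y % 5 + 1 <? 5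
liftable? (brick abc _ _ _) = no id
liftable? (brick cab _ _ _) = no id

planks5 : List Brick
planks5 =
  brick bca 1 2 2 ∷ brick bca 2 1 0 ∷ brick bca 2 1 5 ∷ brick bac 3 2 5 ∷ brick bac 3 2 6 ∷
  brick bca 4 1 2 ∷ brick bac 4 0 7 ∷ brick bac 2 2 7 ∷ brick bca 5 2 2 ∷ brick bca 1 3 2 ∷
  brick bac 3 2 2 ∷ brick bac 4 0 1 ∷ brick bac 2 2 1 ∷ brick bca 5 3 2 ∷ brick bac 6 2 1 ∷
  brick bca 6 1 0 ∷ brick bac 7 2 2 ∷ brick bac 7 2 3 ∷ brick bca 6 1 5 ∷ brick bca 8 1 2 ∷
  brick bac 8 0 1 ∷ brick bca 9 2 2 ∷ brick bac 7 2 6 ∷ brick bac 7 2 5 ∷ []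

planks5-template : Template (size 5 2 1) planks5
planks5-template = template tt tt

planks5≥6 : ∀ i j → χ₃≥ (5 + i) (2 + j) 1 6
-- The long side occurs along the second axis in `bac` and along the third in `bca`, so both axes
-- get the widening by `i`.
planks5≥6 i j = template⇒χ₃≥6 z<s z<s z<s (widen-stretch 2 j) (widen-stretch 5 i) (widen-stretch 5 i)
  planks5-template (All.map (λ {B} → fits {B}) (toWitness {a? = All.all? liftable? planks5} tt))
  where
  fits : ∀ {B} → Liftable B →
    Fits (widen 2 j) (widen 5 i) (widen 5 i) (size 5 2 1) (size (5 + i) (2 + j) 1) B
  fits {brick bac x y z} ok = widen-long 2 j x , widen-long 5 i y , widen-short 5 i z 1 ok
  fits {brick bca x y z} ok = widen-long 2 j x , widen-short 5 i y 1 ok , widen-long 5 i z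

-- Rods: `b = c = 1`.

rods4 : List Brick
rods4 =
  brick bca 4 4 6 ∷ brick abc 3 4 5 ∷ brick cab 3 1 6 ∷ brick bca 4 3 4 ∷ brick cab 3 3 7 ∷
  brick abc 3 5 6 ∷ brick abc 4 5 7 ∷ brick bca 4 6 5 ∷ brick bca 3 6 3 ∷ brick abc 2 5 5 ∷
  brick cab 4 4 4 ∷ brick cab 3 2 4 ∷ brick bca 5 6 4 ∷ brick abc 3 7 5 ∷ brick cab 2 4 6 ∷
  brick bca 6 6 4 ∷ brick abc 5 7 4 ∷ brick abc 5 5 4 ∷ brick abc 6 5 5 ∷ brick cab 7 3 6 ∷
  brick cab 7 6 5 ∷ brick abc 4 7 6 ∷ brick abc 2 7 7 ∷ brick cab 3 7 6 ∷ brick cab 5 5 8 ∷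
  brick abc 2 5 3 ∷ brick cab 2 6 5 ∷ brick cab 2 3 4 ∷ brick abc 1 4 3 ∷ brick abc 4 6 3 ∷
  brick abc 2 7 3 ∷ brick cab 4 4 2 ∷ brick cab 5 5 2 ∷ brick bca 5 8 3 ∷ brick bca 4 8 2 ∷
  brick bca 4 8 6 ∷ brick cab 3 5 2 ∷ brick bca 6 8 2 ∷ brick bca 6 7 0 ∷ brick abc 3 8 1 ∷ []

rods4-template : Template (size 4 1 1) rods4
rods4-template = template tt tt

rods5 : List Brick
rods5 =
  brick abc 1 5 5 ∷ brick bca 3 4 2 ∷ brick cab 2 0 5 ∷ brick cab 2 3 6 ∷ brick cab 3 5 6 ∷
  brick bca 3 3 5 ∷ brick abc 2 4 7 ∷ brick cab 4 4 6 ∷ brick abc 0 2 6 ∷ brick bca 4 3 4 ∷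
  brick cab 5 1 6 ∷ brick abc 4 4 5 ∷ brick abc 3 2 5 ∷ brick abc 5 3 5 ∷ brick cab 5 2 4 ∷
  brick abc 1 5 7 ∷ brick cab 6 0 4 ∷ brick bca 6 5 1 ∷ brick bca 5 6 5 ∷ brick abc 0 6 7 ∷
  brick cab 6 4 6 ∷ brick abc 2 7 7 ∷ brick bca 6 6 1 ∷ brick abc 2 7 5 ∷ brick cab 5 7 6 ∷
  brick abc 3 8 7 ∷ brick cab 3 4 8 ∷ brick cab 2 3 8 ∷ brick bca 2 8 6 ∷ brick cab 4 4 8 ∷
  brick cab 5 1 8 ∷ brick abc 1 2 7 ∷ brick abc 5 3 7 ∷ brick cab 6 3 8 ∷ brick abc 0 2 8 ∷ []

rods5-template : Template (size 5 1 1) rods5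
rods5-template = template tt tt

rods6 : List Brick
rods6 =
  brick bca 7 6 2 ∷ brick cab 7 4 8 ∷ brick abc 3 7 7 ∷ brick bca 6 6 6 ∷ brick abc 3 5 7 ∷
  brick bca 8 6 3 ∷ brick abc 3 5 6 ∷ brick bca 5 6 5 ∷ brick abc 1 5 8 ∷ brick bca 4 6 3 ∷
  brick abc 2 7 6 ∷ brick cab 6 3 5 ∷ brick abc 0 7 5 ∷ brick abc 5 5 9 ∷ brick cab 4 2 9 ∷
  brick bca 3 6 6 ∷ brick abc 0 7 8 ∷ brick abc 2 7 4 ∷ brick bca 3 6 0 ∷ brick bca 2 6 1 ∷
  brick cab 2 6 7 ∷ brick bca 5 8 3 ∷ brick bca 4 8 4 ∷ brick bca 3 8 5 ∷ brick cab 5 7 9 ∷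
  brick bca 6 8 6 ∷ brick bca 7 8 2 ∷ brick abc 0 9 8 ∷ brick abc 3 9 7 ∷ brick bca 6 9 8 ∷
  brick abc 2 10 8 ∷ brick cab 7 6 9 ∷ brick abc 2 7 10 ∷ brick abc 2 9 6 ∷ brick bca 2 6 8 ∷
  brick bca 8 7 8 ∷ brick bca 8 8 4 ∷ brick abc 1 9 5 ∷ brick abc 7 6 10 ∷ brick abc 8 6 9 ∷
  brick abc 4 9 4 ∷ brick cab 3 8 4 ∷ []

rods6-template : Template (size 6 1 1) rods6
rods6-template = template tt tt

-- The coordinates tested are those of the two unit sides, which must avoid `[6 , 7] + 7ℕ`. For
-- rods, `bac` and `cab` have the same shape, so `cab` represents every rod along the second axis.
Extendable : Brick → Set
Extendable (brick abc x y z) = y % 7 + 1 < 7 × z % 7 + 1 < 7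
Extendable (brick bca x y z) = x % 7 + 1 < 7 × y % 7 + 1 < 7
Extendable (brick cab x y z) = x % 7 + 1 < 7 × z % 7 + 1 < 7
Extendable (brick bac x y z) = ⊥

extendable? : ∀ B → Dec (Extendable B)
extendable? (brick abc x y z) = (y % 7 + 1 <? 7) ×-dec (z % 7 + 1 <? 7)
extendable? (brick bca x y z) = (x % 7 + 1 <? 7) ×-dec (y % 7 + 1 <? 7)
extendable? (brick cab x y z) = (x % 7 + 1 <? 7) ×-dec (z % 7 + 1 <? 7)
extendable? (brick bac x y z) = no id

rods7 : List Brick
rods7 =
  brick abc 6 9 12 ∷ brick bca 9 10 9 ∷ brick abc 3 9 11 ∷ brick cab 10 9 11 ∷
  brick bca 8 10 7 ∷ brick abc 8 9 10 ∷ brick abc 7 9 9 ∷ brick bca 10 10 4 ∷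
  brick bca 11 10 9 ∷ brick cab 9 7 8 ∷ brick cab 7 5 10 ∷ brick bca 8 8 5 ∷ brick bca 7 8 11 ∷
  brick bca 9 8 9 ∷ brick bca 10 8 7 ∷ brick cab 11 3 11 ∷ brick abc 4 7 11 ∷ brick abc 8 7 10 ∷
  brick abc 5 7 9 ∷ brick bca 11 8 4 ∷ brick abc 10 9 8 ∷ brick cab 8 2 12 ∷ brick abc 9 9 7 ∷
  brick bca 11 10 2 ∷ brick bca 8 9 2 ∷ brick cab 7 7 8 ∷ brick cab 7 10 9 ∷ brick bca 8 11 8 ∷
  brick abc 9 11 9 ∷ brick abc 9 11 10 ∷ brick abc 3 12 10 ∷ brick abc 9 9 5 ∷ brick abc 9 9 4 ∷
  brick bca 9 10 1 ∷ brick abc 8 11 7 ∷ brick cab 7 8 7 ∷ brick bca 10 8 0 ∷ brick cab 10 9 3 ∷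
  brick cab 11 3 3 ∷ brick bca 10 12 4 ∷ brick abc 10 11 8 ∷ brick bca 11 12 7 ∷
  brick abc 7 11 4 ∷ brick abc 6 11 5 ∷ brick bca 8 10 0 ∷ brick cab 7 4 5 ∷ brick abc 8 7 5 ∷
  brick abc 5 7 4 ∷ []

rods7-template : Template (size 7 1 1) rods7
rods7-template = template tt tt

rods7≥6 : ∀ i → χ₃≥ (7 + i) 1 1 6
rods7≥6 i = template⇒χ₃≥6 z<s z<s z<s W W W rods7-template
  (All.map (λ {B} → fits {B}) (toWitness {a? = All.all? extendable? rods7} tt))
  where
  -- Rods lie along all three axes, so each axis is widened by the same amount.
  W = widen-stretch 7 i
  fits : ∀ {B} → Extendable B →
    Fits (widen 7 i) (widen 7 i) (widen 7 i) (size 7 1 1) (size (7 + i) 1 1) B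
  fits {brick abc x y z} (oky , okz) =
    widen-long 7 i x , widen-short 7 i y 1 oky , widen-short 7 i z 1 okz
  fits {brick bca x y z} (okx , oky) =
    widen-short 7 i x 1 okx , widen-short 7 i y 1 oky , widen-long 7 i z
  fits {brick cab x y z} (okx , okz) =
    widen-short 7 i x 1 okx , widen-long 7 i y , widen-short 7 i z 1 okz

-- The case distinction on the sides.

theorem5p1 : (a b c : ℕ) → 0 < c → c ≤ b → b ≤ a →
    ¬ (a ≡ 1 × b ≡ 1 × c ≡ 1) →
    ¬ (a ≡ 2 × b ≡ 1 × c ≡ 1) →
    ¬ (a ≡ 3 × b ≡ 1 × c ≡ 1) →
    χ₃≥ a b c 6
theorem5p1 (suc (suc i)) (suc (suc j)) (suc (suc k)) _ _ _ _ _ _ = cubes≥6 i j k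
theorem5p1 2 2 1 _ _ _ _ _ _ = unstretched z<s z<s z<s slabs-template
theorem5p1 3 (suc (suc j)) 1 _ _ _ _ _ _ = planks3≥6 j
theorem5p1 4 (suc (suc j)) 1 _ _ _ _ _ _ = planks4≥6 j
theorem5p1 (suc (suc (suc (suc (suc i))))) (suc (suc j)) 1 _ _ _ _ _ _ = planks5≥6 i j
theorem5p1 1 1 1 _ _ _ ≢111 _ _ = contradiction (refl , refl , refl) ≢111
theorem5p1 2 1 1 _ _ _ _ ≢211 _ = contradiction (refl , refl , refl) ≢211
theorem5p1 3 1 1 _ _ _ _ _ ≢311 = contradiction (refl , refl , refl) ≢311
theorem5p1 4 1 1 _ _ _ _ _ _ = unstretched z<s z<s z<s rods4-template
theorem5p1 5 1 1 _ _ _ _ _ _ = unstretched z<s z<s z<s rods5-template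
theorem5p1 6 1 1 _ _ _ _ _ _ = unstretched z<s z<s z<s rods6-template
theorem5p1 (suc (suc (suc (suc (suc (suc (suc i))))))) 1 1 _ _ _ _ _ _ = rods7≥6 i
-- The clauses from here on contradict `c ≤ b` or `b ≤ a`.
theorem5p1 (suc (suc i)) (suc zero) (suc (suc k)) _ (s≤s ()) _ _ _ _
theorem5p1 (suc zero) (suc (suc j)) c _ _ (s≤s ()) _ _ _
theorem5p1 (suc zero) (suc zero) (suc (suc k)) _ (s≤s ()) _ _ _ _
theorem5p1 2 (suc (suc (suc j))) c _ _ (s≤s (s≤s ())) _ _ _
theorem5p1 zero (suc b) c _ _ () _ _ _
theorem5p1 a zero (suc c) _ () _ _ _ _
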